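{- The positive range $\mathcal{H}^+$ has natural density zero: $$\lim_{x\to\infty}\frac{I(x)}{x}=0.$$
   Context: $p(n)$ denotes the number of (unrestricted) partitions of the positive integer $n$, and $H(n):=p(n)-n$. The positive range is $\mathcal{H}^+:=\{H(n):n\ge 4\}$, regarded as a set of positive integers. For real $x$, $I(x):=\#\{m\in\mathcal{H}^+: m\le x\}$. -}

module Defs where

open import Data.Integer.Base as ℤ using (ℤ; +_)
import Data.Integer.Properties as ℤₚ
open import Data.List.Base using (List; []; _∷_; _++_; length; map; filter; upTo; deduplicate)
open import Data.List.Properties using (∷-injectiveˡ; ∷-injectiveʳ; ≡-dec; length-++; length-map)
open import Data.List.Membership.Propositional using (_∈_)
open import Data.List.Membership.Propositional.Properties
open import Data.List.Relation.Unary.All as All using (All; []; _∷_)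
open import Data.List.Relation.Unary.AllPairs using ([]; _∷_)
open import Data.List.Relation.Unary.Any using (here; there)
open import Data.List.Relation.Unary.Linked as Linked using (Linked; []; [-]; _∷_)
open import Data.List.Relation.Unary.Unique.Propositional using (Unique)
import Data.List.Relation.Unary.Unique.Propositional.Properties as Uniqueₚ
import Data.List.Relation.Unary.Unique.DecPropositional.Properties as DecUniqueₚ
open import Data.Nat.Base as ℕ using (ℕ; zero; suc; z≤n; s≤s)
open import Data.Nat.Coprimality as Coprime using (1-coprimeTo)
open import Data.Nat.ListAction using (sum)
import Data.Nat.Properties as ℕₚ
open import Data.Product.Base using (Σ; ∃; _×_; _,_; proj₁; proj₂)
open import Data.Rational.Base as ℚ using (ℚ; 0ℚ; 1ℚ)
import Data.Rational.Properties as ℚₚ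
open import Data.Sum.Base using (_⊎_; inj₁; inj₂)
open import Function.Base using (_∘_)
open import Function.Bundles using (_⇔_; mk⇔; Equivalence)
open import Relation.Binary.Definitions using (tri<; tri≈; tri>)
open import Relation.Binary.PropositionalEquality
open import Relation.Nullary using (¬_; Dec; yes; no; contradiction)
open import Relation.Nullary.Decidable using (¬?)

_HasSize_ : {A : Set} → (A → Set) → ℕ → Set
P HasSize k = ∃ λ xs → Unique xs × (∀ x → x ∈ xs ⇔ P x) × length xs ≡ k

unique-⊆⇒length-≤ : {A : Set} {xs ys : List A} → Unique xs →
                    (∀ {x} → x ∈ xs → x ∈ ys) → length xs ℕ.≤ length ys
unique-⊆⇒length-≤ [] _ = z≤n
unique-⊆⇒length-≤ {xs = x ∷ xs} (x∉xs ∷ u) xs⊆ys with ∈-∃++ (xs⊆ys (here refl))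
... | us , vs , refl = begin
  suc (length xs)                 ≤⟨ s≤s (unique-⊆⇒length-≤ u rest) ⟩
  suc (length (us ++ vs))         ≡⟨ cong suc (length-++ us) ⟩
  suc (length us ℕ.+ length vs)   ≡⟨ ℕₚ.+-suc (length us) (length vs) ⟨
  length us ℕ.+ suc (length vs)   ≡⟨ length-++ us ⟨
  length (us ++ x ∷ vs)           ∎
  where
  open ℕₚ.≤-Reasoning
  rest : ∀ {y} → y ∈ xs → y ∈ us ++ vs
  rest y∈xs with ∈-++⁻ us (xs⊆ys (there y∈xs))
  ... | inj₁ y∈us          = ∈-++⁺ˡ y∈us
  ... | inj₂ (here refl)   = contradiction refl (All.lookup x∉xs y∈xs)
  ... | inj₂ (there y∈vs)  = ∈-++⁺ʳ us y∈vs

HasSize-unique : {A : Set} {P : A → Set} {j k : ℕ} → P HasSize j → P HasSize k → j ≡ k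
HasSize-unique (xs , u , xs⇔P , refl) (ys , v , ys⇔P , refl) = ℕₚ.≤-antisym
  (unique-⊆⇒length-≤ u (λ x∈xs → from (ys⇔P _) (to (xs⇔P _) x∈xs)))
  (unique-⊆⇒length-≤ v (λ y∈ys → from (xs⇔P _) (to (ys⇔P _) y∈ys)))
  where open Equivalence

-- Parts are listed in nondecreasing order.
IsPartition : ℕ → List ℕ → Set
IsPartition n xs = All (1 ℕ.≤_) xs × Linked ℕ._≤_ xs × sum xs ≡ n

-- compositionsFrom a n lists the compositions of 1 + a + n with first
-- part at least 1 + a.
compositionsFrom : ℕ → ℕ → List (List ℕ)
compositionsFrom a zero    = (suc a ∷ []) ∷ []
compositionsFrom a (suc n) = map (suc a ∷_) (compositionsFrom 0 n) ++ compositionsFrom (suc a) n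

compositions : ℕ → List (List ℕ)
compositions zero    = [] ∷ []
compositions (suc n) = compositionsFrom 0 n

partitions : ℕ → List (List ℕ)
partitions n = filter (Linked.linked? ℕₚ._≤?_) (compositions n)

p : ℕ → ℕ
p n = length (partitions n)

private
  shift : ∀ a n → suc (a ℕ.+ suc n) ≡ suc (suc a ℕ.+ n)
  shift a n = cong suc (ℕₚ.+-suc a n)

  from-sound : ∀ a n {xs} → xs ∈ compositionsFrom a n →
               All (1 ℕ.≤_) xs × sum xs ≡ suc (a ℕ.+ n)
  from-sound a zero (here refl) = s≤s z≤n ∷ [] , refl
  from-sound a (suc n) xs∈ with ∈-++⁻ (map (suc a ∷_) (compositionsFrom 0 n)) xs∈
  ... | inj₂ q = let pos , s = from-sound (suc a) n q in pos , trans s (sym (shift a n))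
  ... | inj₁ q with ∈-map⁻ (suc a ∷_) q
  ...   | ys , ys∈ , refl =
          let pos , s = from-sound 0 n ys∈ in s≤s z≤n ∷ pos , cong (suc a ℕ.+_) s

  from-head : ∀ a n {x xs} → (x ∷ xs) ∈ compositionsFrom a n → suc a ℕ.≤ x
  from-head a zero (here refl) = ℕₚ.≤-refl
  from-head a (suc n) xs∈ with ∈-++⁻ (map (suc a ∷_) (compositionsFrom 0 n)) xs∈
  ... | inj₂ q = ℕₚ.<⇒≤ (from-head (suc a) n q)
  ... | inj₁ q with ∈-map⁻ (suc a ∷_) q
  ...   | ys , ys∈ , refl = ℕₚ.≤-refl

  from-unique : ∀ a n → Unique (compositionsFrom a n)
  from-unique a zero = [] ∷ []
  from-unique a (suc n) = Uniqueₚ.++⁺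
    (Uniqueₚ.map⁺ ∷-injectiveʳ (from-unique 0 n)) (from-unique (suc a) n) disjoint
    where
    disjoint : ∀ {xs} → ¬ (xs ∈ map (suc a ∷_) (compositionsFrom 0 n)
                           × xs ∈ compositionsFrom (suc a) n)
    disjoint (q , r) with ∈-map⁻ (suc a ∷_) q
    ... | ys , ys∈ , refl = ℕₚ.1+n≰n (from-head (suc a) n r)

  from-complete : ∀ a d n xs → All (1 ℕ.≤_) xs →
                  suc (a ℕ.+ d) ℕ.+ sum xs ≡ suc (a ℕ.+ n) →
                  (suc (a ℕ.+ d) ∷ xs) ∈ compositionsFrom a n
  from-complete a zero zero [] _ _ rewrite ℕₚ.+-identityʳ a = here refl
  from-complete a zero zero (suc x ∷ xs) _ e
    rewrite ℕₚ.+-identityʳ a = contradiction (ℕₚ.+-cancelˡ-≡ a _ 0 (trans (ℕₚ.suc-injective e) (sym (ℕₚ.+-identityʳ a)))) λ ()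
  from-complete a zero zero (zero ∷ xs) (() ∷ _) _
  from-complete a zero (suc n) [] _ e
    rewrite ℕₚ.+-identityʳ a = contradiction (ℕₚ.+-cancelˡ-≡ a _ _ (ℕₚ.suc-injective e)) λ ()
  from-complete a zero (suc n) (zero ∷ xs) (() ∷ _) _
  from-complete a zero (suc n) (suc x ∷ xs) (_ ∷ pos) e
    rewrite ℕₚ.+-identityʳ a = ∈-++⁺ˡ (∈-map⁺ (suc a ∷_)
      (from-complete 0 x n xs pos (ℕₚ.+-cancelˡ-≡ a _ _ (ℕₚ.suc-injective e))))
  from-complete a (suc d) zero xs _ e =
    contradiction (ℕₚ.m+n≡0⇒m≡0 (suc d) (ℕₚ.+-cancelˡ-≡ a _ 0
      (trans (sym (ℕₚ.+-assoc a (suc d) (sum xs))) (ℕₚ.suc-injective e)))) λ ()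
  from-complete a (suc d) (suc n) xs pos e = ∈-++⁺ʳ (map (suc a ∷_) (compositionsFrom 0 n))
    (subst (λ h → (h ∷ xs) ∈ compositionsFrom (suc a) n) (sym (shift a d))
      (from-complete (suc a) d n xs pos
        (trans (cong (ℕ._+ sum xs) (sym (shift a d))) (trans e (shift a n)))))

  comp-sound : ∀ n {xs} → xs ∈ compositions n → All (1 ℕ.≤_) xs × sum xs ≡ n
  comp-sound zero    (here refl) = [] , refl
  comp-sound (suc n) xs∈         = from-sound 0 n xs∈

  comp-complete : ∀ n xs → All (1 ℕ.≤_) xs → sum xs ≡ n → xs ∈ compositions n
  comp-complete zero    []           _         _ = here refl
  comp-complete zero    (suc x ∷ xs) _         ()
  comp-complete (suc n) (suc x ∷ xs) (_ ∷ pos) e = from-complete 0 x n xs pos e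
  comp-complete _       (zero ∷ xs)  (() ∷ _)  _

  comp-unique : ∀ n → Unique (compositions n)
  comp-unique zero    = [] ∷ []
  comp-unique (suc n) = from-unique 0 n

p-counts-partitions : ∀ n → IsPartition n HasSize p n
p-counts-partitions n =
  partitions n , Uniqueₚ.filter⁺ _ (comp-unique n) , (λ xs → mk⇔ to from) , refl
  where
  to : ∀ {xs} → xs ∈ partitions n → IsPartition n xs
  to xs∈ = let c , l = ∈-filter⁻ (Linked.linked? ℕₚ._≤?_) {xs = compositions n} xs∈
               pos , s = comp-sound n c in pos , l , s
  from : ∀ {xs} → IsPartition n xs → xs ∈ partitions n
  from (pos , l , s) = ∈-filter⁺ (Linked.linked? ℕₚ._≤?_) (comp-complete n _ pos s) l

H : ℕ → ℤ
H n = + p n ℤ.- + n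

ℋ⁺ : ℕ → Set
ℋ⁺ m = ∃ λ n → 4 ℕ.≤ n × + m ≡ H n

private
  p-step : ∀ n → 2 ℕ.+ p (3 ℕ.+ n) ℕ.≤ p (4 ℕ.+ n)
  p-step n = subst (λ k → 2 ℕ.+ k ℕ.≤ p (4 ℕ.+ n)) (length-map (1 ∷_) ps)
    (unique-⊆⇒length-≤ (((λ ()) ∷ All.tabulate (one _ (s≤s (s≤s z≤n)))) ∷
       All.tabulate (one _ (s≤s (s≤s z≤n))) ∷
       Uniqueₚ.map⁺ ∷-injectiveʳ (proj₁ (proj₂ (p-counts-partitions (3 ℕ.+ n)))))
      incl)
    where
    open Equivalence
    ps : List (List ℕ)
    ps = partitions (3 ℕ.+ n)
    one : ∀ {x} xs {ys} → 2 ℕ.≤ x → ys ∈ map (1 ∷_) ps → (x ∷ xs) ≢ ys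
    one xs 2≤x q refl with ∈-map⁻ (1 ∷_) q
    one xs (s≤s ()) q refl | _ , _ , refl
    cons : ∀ {xs} → IsPartition (3 ℕ.+ n) xs → IsPartition (4 ℕ.+ n) (1 ∷ xs)
    cons {[]}    (_ , _ , ())
    cons {x ∷ _} (a ∷ as , l , s) = (s≤s z≤n ∷ a ∷ as) , (a ∷ l) , cong suc s
    parts : ∀ {xs} → IsPartition (4 ℕ.+ n) xs → xs ∈ partitions (4 ℕ.+ n)
    parts = from (proj₁ (proj₂ (proj₂ (p-counts-partitions (4 ℕ.+ n)))) _)
    incl : ∀ {xs} → xs ∈ (4 ℕ.+ n ∷ []) ∷ (2 ∷ 2 ℕ.+ n ∷ []) ∷ map (1 ∷_) ps →
           xs ∈ partitions (4 ℕ.+ n)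
    incl (here refl) = parts (s≤s z≤n ∷ [] , [-] , ℕₚ.+-identityʳ _)
    incl (there (here refl)) = parts
      (s≤s z≤n ∷ s≤s z≤n ∷ [] , s≤s (s≤s z≤n) ∷ [-] , cong (4 ℕ.+_) (ℕₚ.+-identityʳ n))
    incl (there (there q)) with ∈-map⁻ (1 ∷_) q
    ... | ys , ys∈ , refl =
          parts (cons (to (proj₁ (proj₂ (proj₂ (p-counts-partitions (3 ℕ.+ n)))) _) ys∈))

  p-growth : ∀ j → suc j ℕ.+ (4 ℕ.+ j) ℕ.≤ p (4 ℕ.+ j)
  p-growth zero    = ℕₚ.≤-refl
  p-growth (suc j) = ℕₚ.≤-trans
    (ℕₚ.≤-reflexive (cong (suc ∘ suc) (ℕₚ.+-suc j (4 ℕ.+ j))))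
    (ℕₚ.≤-trans (s≤s (s≤s (p-growth j))) (p-step (suc j)))

  H⁺ : ℕ → ℕ
  H⁺ j = p (4 ℕ.+ j) ℕ.∸ (4 ℕ.+ j)

  +H⁺ : ∀ j → + H⁺ j ≡ H (4 ℕ.+ j)
  +H⁺ j = trans (sym (ℤₚ.⊖-≥ (ℕₚ.≤-trans (ℕₚ.m≤n+m _ (suc j)) (p-growth j))))
                (sym (ℤₚ.m-n≡m⊖n (p (4 ℕ.+ j)) (4 ℕ.+ j)))

  H⁺-growth : ∀ j → suc j ℕ.≤ H⁺ j
  H⁺-growth j = ℕₚ.m+n≤o⇒m≤o∸n (suc j) (p-growth j)

-- Nothing is lost by taking ℋ⁺ to be a set of natural numbers.
H-positive : ∀ n → 4 ℕ.≤ n → ℤ.0ℤ ℤ.< H n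
H-positive (suc (suc (suc (suc j)))) (s≤s (s≤s (s≤s (s≤s _)))) =
  subst (ℤ.0ℤ ℤ.<_) (+H⁺ j) (ℤ.+<+ (ℕₚ.≤-trans (s≤s z≤n) (H⁺-growth j)))

-- Dedekind cuts; q <ˡ x reads "q < x" and x <ᵘ r reads "x < r".
record ℝ : Set₁ where
  field
    Lower Upper  : ℚ → Set
    lower-exists : ∃ Lower
    upper-exists : ∃ Upper
    lower-closed : ∀ {q r} → q ℚ.< r → Lower r → Lower q
    upper-closed : ∀ {q r} → q ℚ.< r → Upper q → Upper r
    lower-open   : ∀ {q} → Lower q → ∃ λ r → q ℚ.< r × Lower r
    upper-open   : ∀ {r} → Upper r → ∃ λ q → q ℚ.< r × Upper q
    ordered      : ∀ {q r} → Lower q → Upper r → q ℚ.< r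
    located      : ∀ {q r} → q ℚ.< r → Lower q ⊎ Upper r

infix 4 _<ˡ_ _<ᵘ_ _≤ˡ_

_<ˡ_ : ℚ → ℝ → Set
q <ˡ x = ℝ.Lower x q

_<ᵘ_ : ℝ → ℚ → Set
x <ᵘ r = ℝ.Upper x r

_≤ˡ_ : ℚ → ℝ → Set
q ≤ˡ x = ¬ (x <ᵘ q)

fromℚ : ℚ → ℝ
fromℚ q = record
  { Lower        = ℚ._< q
  ; Upper        = q ℚ.<_
  ; lower-exists = q ℚ.- 1ℚ , subst (q ℚ.- 1ℚ ℚ.<_) (ℚₚ.+-identityʳ q)
                                (ℚₚ.+-monoʳ-< q {ℚ.- 1ℚ} {0ℚ} (ℚₚ.negative⁻¹ (ℚ.- 1ℚ)))
  ; upper-exists = q ℚ.+ 1ℚ , subst (ℚ._< q ℚ.+ 1ℚ) (ℚₚ.+-identityʳ q)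
                                (ℚₚ.+-monoʳ-< q {0ℚ} {1ℚ} (ℚₚ.positive⁻¹ 1ℚ))
  ; lower-closed = ℚₚ.<-trans
  ; upper-closed = λ a b → ℚₚ.<-trans b a
  ; lower-open   = ℚₚ.<-dense
  ; upper-open   = λ l → let r , a , b = ℚₚ.<-dense l in r , b , a
  ; ordered      = ℚₚ.<-trans
  ; located      = loc
  }
  where
  loc : ∀ {a b} → a ℚ.< b → a ℚ.< q ⊎ q ℚ.< b
  loc {a} {b} a<b with a ℚₚ.<? q
  ... | yes a<q = inj₁ a<q
  ... | no  a≮q = inj₂ (ℚₚ.≤-<-trans (ℚₚ.≮⇒≥ a≮q) a<b)

fromℕ : ℕ → ℚ
fromℕ n = + n ℚ./ 1

private
  quot : ∀ s u → 0ℚ ℚ.< u → Σ ℚ λ r → r ℚ.* u ≡ s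
  quot s u 0<u = s ℚ.* ℚ.1/ u ,
    trans (ℚₚ.*-assoc s (ℚ.1/ u) u)
      (trans (cong (s ℚ.*_) (ℚₚ.*-inverseˡ u)) (ℚₚ.*-identityʳ s))
    where instance
      u≢0 : ℚ.NonZero u
      u≢0 = ℚₚ.pos⇒nonZero u {{ℚ.positive 0<u}}

  mono : ∀ {q r} u → 0ℚ ℚ.< u → q ℚ.< r → q ℚ.* u ℚ.< r ℚ.* u
  mono u 0<u = ℚₚ.*-monoˡ-<-pos u {{ℚ.positive 0<u}}

  monoˡ : ∀ {q r} u → 0ℚ ℚ.< u → q ℚ.< r → u ℚ.* q ℚ.< u ℚ.* r
  monoˡ u 0<u = ℚₚ.*-monoʳ-<-pos u {{ℚ.positive 0<u}}

  cancel : ∀ {q r} u → 0ℚ ℚ.< u → q ℚ.* u ℚ.< r ℚ.* u → q ℚ.< r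
  cancel u 0<u = ℚₚ.*-cancelʳ-<-nonNeg u {{ℚₚ.pos⇒nonNeg u {{ℚ.positive 0<u}}}}

  module Quotient (c : ℚ) (0≤c : 0ℚ ℚ.≤ c) (x : ℝ) (0<x : 0ℚ <ˡ x) where
    open ℝ x

    Lo Up : ℚ → Set
    Lo q = ∃ λ u → x <ᵘ u × q ℚ.* u ℚ.< c
    Up q = ∃ λ l → 0ℚ ℚ.< l × l <ˡ x × c ℚ.< q ℚ.* l

    pos : ∀ {u} → x <ᵘ u → 0ℚ ℚ.< u
    pos = ordered 0<x

    neg-lo : ∀ {q} → q ℚ.< 0ℚ → Lo q
    neg-lo {q} q<0 = let u , x<u = upper-exists in
      u , x<u , ℚₚ.<-≤-trans (subst (q ℚ.* u ℚ.<_) (ℚₚ.*-zeroˡ u) (mono u (pos x<u) q<0)) 0≤c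

    loc : ∀ {q r} → q ℚ.< r → Lo q ⊎ Up r
    loc {q} {r} q<r with ℚₚ.<-cmp r 0ℚ
    ... | tri< r<0 _ _ = inj₁ (neg-lo (ℚₚ.<-trans q<r r<0))
    ... | tri≈ _ refl _ = inj₁ (neg-lo q<r)
    ... | tri> _ _ 0<r with 0ℚ ℚₚ.<? c
    ...   | no 0≮c = inj₂ (let l , 0<l , l<x = lower-open 0<x in
              l , 0<l , l<x , ℚₚ.≤-<-trans (ℚₚ.≮⇒≥ 0≮c)
                (subst (ℚ._< r ℚ.* l) (ℚₚ.*-zeroˡ l) (mono l 0<l 0<r)))
    ...   | yes 0<c with 0ℚ ℚₚ.<? q
    ...     | no 0≮q = inj₁ (let u , x<u = upper-exists in
                u , x<u , ℚₚ.≤-<-trans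
                  (subst (q ℚ.* u ℚ.≤_) (ℚₚ.*-zeroˡ u)
                    (ℚₚ.*-monoʳ-≤-nonNeg u {{ℚₚ.pos⇒nonNeg u {{ℚ.positive (pos x<u)}}}}
                      (ℚₚ.≮⇒≥ 0≮q)))
                  0<c)
    ...     | yes 0<q with quot c r 0<r | quot c q 0<q
    ...       | a , ar≡c | b , bq≡c with located a<b
      where
      0<b : 0ℚ ℚ.< b
      0<b = cancel q 0<q (subst₂ ℚ._<_ (sym (ℚₚ.*-zeroˡ q)) (sym bq≡c) 0<c)
      a<b : a ℚ.< b
      a<b = cancel r 0<r (subst (ℚ._< b ℚ.* r) (trans bq≡c (sym ar≡c)) (monoˡ b 0<b q<r))
    ...         | inj₁ a<x = inj₂ (let l , a<l , l<x = lower-open a<x in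
                    l , ℚₚ.<-trans 0<a a<l , l<x ,
                    subst (ℚ._< r ℚ.* l) (trans (ℚₚ.*-comm r a) ar≡c) (monoˡ r 0<r a<l))
      where
      0<a : 0ℚ ℚ.< a
      0<a = cancel r 0<r (subst₂ ℚ._<_ (sym (ℚₚ.*-zeroˡ r)) (sym ar≡c) 0<c)
    ...         | inj₂ x<b = inj₁ (let u , u<b , x<u = upper-open x<b in
                    u , x<u ,
                    subst (q ℚ.* u ℚ.<_) (trans (ℚₚ.*-comm q b) bq≡c) (monoˡ q 0<q u<b))

    ord : ∀ {q r} → Lo q → Up r → q ℚ.< r
    ord {q} {r} (u , x<u , qu<c) (l , 0<l , l<x , c<rl) with q ℚₚ.<? r
    ... | yes q<r = q<r
    ... | no q≮r = contradiction (ℚₚ.<-trans rl<ru ru<rl) (ℚₚ.<-irrefl refl)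
      where
      0<r : 0ℚ ℚ.< r
      0<r = cancel l 0<l (subst (ℚ._< r ℚ.* l) (sym (ℚₚ.*-zeroˡ l)) (ℚₚ.≤-<-trans 0≤c c<rl))
      rl<ru : r ℚ.* l ℚ.< r ℚ.* u
      rl<ru = monoˡ r 0<r (ordered l<x x<u)
      ru<rl : r ℚ.* u ℚ.< r ℚ.* l
      ru<rl = ℚₚ.<-trans (ℚₚ.≤-<-trans
        (ℚₚ.*-monoʳ-≤-nonNeg u {{ℚₚ.pos⇒nonNeg u {{ℚ.positive (pos x<u)}}}} (ℚₚ.≮⇒≥ q≮r))
        qu<c) c<rl

    lo-open : ∀ {q} → Lo q → ∃ λ r → q ℚ.< r × Lo r
    lo-open (u , x<u , qu<c) =
      let s , qu<s , s<c = ℚₚ.<-dense qu<c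
          r , ru≡s       = quot s u (pos x<u)
      in r , cancel u (pos x<u) (subst (_ ℚ.<_) (sym ru≡s) qu<s)
           , u , x<u , subst (ℚ._< c) (sym ru≡s) s<c

    up-open : ∀ {r} → Up r → ∃ λ q → q ℚ.< r × Up q
    up-open (l , 0<l , l<x , c<rl) =
      let s , c<s , s<rl = ℚₚ.<-dense c<rl
          q , ql≡s       = quot s l 0<l
      in q , cancel l 0<l (subst (ℚ._< _) (sym ql≡s) s<rl)
           , l , 0<l , l<x , subst (c ℚ.<_) (sym ql≡s) c<s

    up-exists : ∃ Up
    up-exists =
      let l , 0<l , l<x = lower-open 0<x
          s , c<s       = ℝ.upper-exists (fromℚ c)
          q , ql≡s      = quot s l 0<l
      in q , l , 0<l , l<x , subst (c ℚ.<_) (sym ql≡s) c<s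

    quotient : ℝ
    quotient = record
      { Lower        = Lo
      ; Upper        = Up
      ; lower-exists = ℚ.- 1ℚ , neg-lo (ℚₚ.negative⁻¹ (ℚ.- 1ℚ))
      ; upper-exists = up-exists
      ; lower-closed = λ q<r (u , x<u , ru<c) → u , x<u , ℚₚ.<-trans (mono u (pos x<u) q<r) ru<c
      ; upper-closed = λ q<r (l , 0<l , l<x , c<ql) →
          l , 0<l , l<x , ℚₚ.<-trans c<ql (mono l 0<l q<r)
      ; lower-open   = lo-open
      ; upper-open   = up-open
      ; ordered      = ord
      ; located      = loc
      }

  0≤fromℕ : ∀ n → 0ℚ ℚ.≤ fromℕ n
  0≤fromℕ n = ℚₚ.nonNegative⁻¹ (fromℕ n) {{ℚₚ.normalize-nonNeg n 1}}

-- k / x: a rational q is below it iff q * u < k for some u > x, and above it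
-- iff k < q * l for some l with 0 < l < x.
quotient : ℕ → (x : ℝ) → 0ℚ <ˡ x → ℝ
quotient k = Quotient.quotient (fromℕ k) (0≤fromℕ k)

-- f is a partial function with domain D.  Restricting ε and X to rationals
-- is harmless, since ℚ is dense and cofinal in ℝ.
Limit∞ : (D : ℝ → Set) → (∀ x → D x → ℝ) → ℚ → Set₁
Limit∞ D f ℓ = ∀ (ε : ℚ) → 0ℚ ℚ.< ε → ∃ λ (X : ℚ) → ∀ (x : ℝ) → X <ˡ x → (d : D x) →
  ℓ ℚ.- ε <ˡ f x d × f x d <ᵘ ℓ ℚ.+ ε

-- Counts A x k says that A has exactly k elements m ≤ x.  The count is a
-- relation because no floor function on ℝ is definable constructively.
Counts : (ℕ → Set) → ℝ → ℕ → Set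
Counts A x k = (λ m → A m × fromℕ m ≤ˡ x) HasSize k

ProportionDomain : (ℕ → Set) → ℝ → Set
ProportionDomain A x = 0ℚ <ˡ x × ∃ (Counts A x)

proportion : ∀ A x → ProportionDomain A x → ℝ
proportion A x (0<x , k , _) = quotient k x 0<x

HasNaturalDensity : (ℕ → Set) → ℚ → Set₁
HasNaturalDensity A = Limit∞ (ProportionDomain A) (proportion A)

private
  fromℕ-≡ : ∀ n → fromℕ n ≡ ℚ.mkℚ (+ n) 0 (Coprime.sym (1-coprimeTo n))
  fromℕ-≡ n = ℚₚ.normalize-coprime (Coprime.sym (1-coprimeTo n))

  fromℕ-mono-≤ : ∀ {m n} → m ℕ.≤ n → fromℕ m ℚ.≤ fromℕ n
  fromℕ-mono-≤ {m} {n} m≤n rewrite fromℕ-≡ m | fromℕ-≡ n =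
    ℚ.*≤* (ℤₚ.*-monoʳ-≤-nonNeg (+ 1) (ℤ.+≤+ m≤n))

  archimedean : ∀ q → ∃ λ N → q ℚ.≤ fromℕ N
  archimedean q@(ℚ.mkℚ (+ n) d _) = n , subst (q ℚ.≤_) (sym (fromℕ-≡ n))
    (ℚ.*≤* (ℤₚ.*-monoˡ-≤-nonNeg (+ n) (ℤ.+≤+ (s≤s z≤n))))
  archimedean (ℚ.mkℚ ℤ.-[1+ _ ] _ _) = 0 , ℚ.*≤* ℤ.-≤+

-- The counting function of ℋ⁺ is defined wherever natural numbers can be
-- compared with x (classically, for every x), in particular at rationals.
ℋ⁺-count : ∀ x → (∀ m → Dec (fromℕ m ≤ˡ x)) → ∃ (Counts ℋ⁺ x)
ℋ⁺-count x _≤x? = length elems , elems , DecUniqueₚ.deduplicate-! ℕₚ._≟_ _ ,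
  (λ m → mk⇔ to from) , refl
  where
  u = proj₁ (ℝ.upper-exists x)
  N = proj₁ (archimedean u)
  candidates elems : List ℕ
  candidates = filter _≤x? (map H⁺ (upTo N))
  elems = deduplicate ℕₚ._≟_ candidates

  to : ∀ {m} → m ∈ elems → ℋ⁺ m × fromℕ m ≤ˡ x
  to m∈ with ∈-filter⁻ _≤x? {xs = map H⁺ (upTo N)} (∈-deduplicate⁻ ℕₚ._≟_ candidates m∈)
  ... | q , m≤x with ∈-map⁻ H⁺ q
  ...   | j , _ , refl = (4 ℕ.+ j , s≤s (s≤s (s≤s (s≤s z≤n))) , +H⁺ j) , m≤x

  from : ∀ {m} → ℋ⁺ m × fromℕ m ≤ˡ x → m ∈ elems
  from {m} ((suc (suc (suc (suc j))) , s≤s (s≤s (s≤s (s≤s _))) , e) , m≤x)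
    with refl ← ℤₚ.+-injective (trans e (sym (+H⁺ j))) =
    ∈-deduplicate⁺ ℕₚ._≟_ (∈-filter⁺ _≤x? (∈-map⁺ H⁺ (∈-upTo⁺ j<N)) m≤x)
    where
    j<N : j ℕ.< N
    j<N with suc j ℕₚ.≤? N
    ... | yes l = l
    ... | no ¬l = contradiction x<m m≤x
      where
      u≤m : u ℚ.≤ fromℕ (H⁺ j)
      u≤m = ℚₚ.≤-trans (proj₂ (archimedean u))
        (fromℕ-mono-≤ (ℕₚ.≤-trans (ℕₚ.≮⇒≥ ¬l) (ℕₚ.≤-trans (ℕₚ.n≤1+n j) (H⁺-growth j))))
      x<m : x <ᵘ fromℕ (H⁺ j)
      x<m = let v , v<u , x<v = ℝ.upper-open x (proj₂ (ℝ.upper-exists x)) in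
        ℝ.upper-closed x (ℚₚ.<-≤-trans v<u u≤m) x<v

ℋ⁺-count-ℚ : ∀ q → ∃ (Counts ℋ⁺ (fromℚ q))
ℋ⁺-count-ℚ q = ℋ⁺-count (fromℚ q) λ m → ¬? (q ℚₚ.<? fromℕ m)

{-# OPTIONS --safe #-}
module Submission where

-- Adding a part 1 embeds the partitions of n in those of n + 1, and about n / 2
-- partitions of n + 1 into two parts ≥ 2 are missed.  Hence p grows faster than
-- every linear function, so for each M only O(1) + B / M indices n have H(n) ≤ B;
-- letting M grow gives density zero.

open import Defs
open import Data.Rational.Base using (0ℚ)

import Data.Integer.Base as ℤ
import Data.Integer.Properties as ℤₚ
open import Data.List.Base using (List; []; _∷_; _++_; length; map; upTo)
open import Data.List.Membership.Propositional using (_∈_)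
open import Data.List.Membership.Propositional.Properties
open import Data.List.Properties using (∷-injectiveˡ; ∷-injectiveʳ; length-++; length-map; length-upTo)
open import Data.List.Relation.Unary.All using ([]; _∷_)
open import Data.List.Relation.Unary.Linked using ([-]; _∷_)
open import Data.List.Relation.Unary.Unique.Propositional using (Unique)
import Data.List.Relation.Unary.Unique.Propositional.Properties as Uniqueₚ
open import Data.Nat.Base
open import Data.Nat.DivMod using (_/_; m/n*n≤m; /-monoˡ-≤; m*n/n≡m)
open import Data.Nat.Properties
open import Data.Nat.Solver using (module +-*-Solver)
open import Data.Product.Base using (∃; _×_; _,_; proj₁; proj₂)
import Data.Rational.Base as ℚ
import Data.Rational.Properties as ℚₚ
open import Data.Rational.Unnormalised.Base as ℚᵘ using (mkℚᵘ)
import Data.Rational.Unnormalised.Properties as ℚᵘₚ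
open import Data.Sum.Base using (inj₁; inj₂)
open import Function.Base using (_∘_)
open import Function.Bundles using (Equivalence)
open import Relation.Binary.PropositionalEquality hiding (J)
open import Relation.Nullary using (¬_; yes; no; contradiction)

open Equivalence using (to; from)

-- Superlinear growth of the partition function.

∈-partitions : ∀ {n xs} → IsPartition n xs → xs ∈ partitions n
∈-partitions {n} = from (proj₁ (proj₂ (proj₂ (p-counts-partitions n))) _)

partitions-sound : ∀ n {xs} → xs ∈ partitions n → IsPartition n xs
partitions-sound n = to (proj₁ (proj₂ (proj₂ (p-counts-partitions n))) _)

partitions-unique : ∀ n → Unique (partitions n)
partitions-unique n = proj₁ (proj₂ (p-counts-partitions n))

cons-1 : ∀ {n xs} → IsPartition n xs → IsPartition (suc n) (1 ∷ xs)
cons-1 {xs = []}    (_ , _ , s)      = s≤s z≤n ∷ [] , [-] , cong suc s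
cons-1 {xs = _ ∷ _} (a ∷ as , l , s) = s≤s z≤n ∷ a ∷ as , a ∷ l , cong suc s

-- The lists `pair i` start with a part at least 2, so they avoid every `1 ∷ xs`. The hypothesis
-- makes even the last pair, with first part `suc g`, nondecreasing.
p-increment : ∀ g n → 2 * suc g ≤ suc n → g + p n ≤ p (suc n)
p-increment g n 2g+2≤ = subst (_≤ p (suc n)) length-family
  (unique-⊆⇒length-≤ family-unique family⊆partitions)
  where
  pair : ℕ → List ℕ
  pair i = 2 + i ∷ suc n ∸ (2 + i) ∷ []

  family : List (List ℕ)
  family = map pair (upTo g) ++ map (1 ∷_) (partitions n)

  length-family : length family ≡ g + p n
  length-family = trans (length-++ (map pair (upTo g)))
    (cong₂ _+_ (trans (length-map pair (upTo g)) (length-upTo g))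
               (length-map (1 ∷_) (partitions n)))

  disjoint : ∀ {xs} → ¬ (xs ∈ map pair (upTo g) × xs ∈ map (1 ∷_) (partitions n))
  disjoint (q , r) with ∈-map⁻ pair q | ∈-map⁻ (1 ∷_) r
  ... | _ , _ , refl | _ , _ , ()

  family-unique : Unique family
  family-unique = Uniqueₚ.++⁺
    (Uniqueₚ.map⁺ (suc-injective ∘ suc-injective ∘ ∷-injectiveˡ) (Uniqueₚ.upTo⁺ g))
    (Uniqueₚ.map⁺ ∷-injectiveʳ (partitions-unique n))
    disjoint

  pair-isPartition : ∀ {i} → i < g → IsPartition (suc n) (pair i)
  pair-isPartition {i} i<g =
    s≤s z≤n ∷ ≤-trans (s≤s z≤n) small≤large ∷ [] ,
    small≤large ∷ [-] ,
    trans (cong (2 + i +_) (+-identityʳ _))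
          (m+[n∸m]≡n (≤-trans (m≤m+n (2 + i) _) twice≤))
    where
    twice≤ : 2 * (2 + i) ≤ suc n
    twice≤ = ≤-trans (*-monoʳ-≤ 2 (s≤s i<g)) 2g+2≤
    small≤large : 2 + i ≤ suc n ∸ (2 + i)
    small≤large = m+n≤o⇒m≤o∸n (2 + i)
      (subst (λ k → 2 + i + k ≤ suc n) (+-identityʳ (2 + i)) twice≤)

  family⊆partitions : ∀ {xs} → xs ∈ family → xs ∈ partitions (suc n)
  family⊆partitions xs∈ with ∈-++⁻ (map pair (upTo g)) xs∈
  ... | inj₁ q with ∈-map⁻ pair q
  ...   | i , i∈ , refl = ∈-partitions (pair-isPartition (∈-upTo⁻ i∈))
  family⊆partitions xs∈ | inj₂ q with ∈-map⁻ (1 ∷_) q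
  ...   | ys , ys∈ , refl = ∈-partitions (cons-1 (partitions-sound n ys∈))

-- Starting at `2 * suc g`, every one of the `d` steps meets the hypothesis of `p-increment` and
-- gains `g`.
p-linear : ∀ g d → d * g ≤ p (d + 2 * suc g)
p-linear g zero    = z≤n
p-linear g (suc d) = ≤-trans (+-monoʳ-≤ g (p-linear g d))
  (p-increment g (d + 2 * suc g) (≤-trans (m≤n+m _ d) (n≤1+n _)))

p-superlinear : ∀ M → ∃ λ J → ∀ {n} → J ≤ n → n * M ≤ p n
-- With `n = d + c`, slope `suc M` gives `d * M + d`; the extra `d` pays for the offset `c * M` as
-- soon as `d ≥ M * c`.
p-superlinear M = c + M * c , bound
  where
  c = 2 * suc (suc M)
  bound : ∀ {n} → c + M * c ≤ n → n * M ≤ p n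
  bound {n} J≤n = subst (λ k → k * M ≤ p k) (m∸n+n≡m (≤-trans (m≤m+n c _) J≤n)) (begin
    (d + c) * M    ≡⟨ *-distribʳ-+ M d c ⟩
    d * M + c * M  ≡⟨ cong (d * M +_) (*-comm c M) ⟩
    d * M + M * c  ≤⟨ +-monoʳ-≤ (d * M) (m+n≤o⇒m≤o∸n (M * c) (subst (_≤ n) (+-comm c _) J≤n)) ⟩
    d * M + d      ≡⟨ +-comm (d * M) d ⟩
    d + d * M      ≡⟨ *-suc d M ⟨
    d * suc M      ≤⟨ p-linear (suc M) d ⟩
    p (d + c)      ∎)
    where
    open ≤-Reasoning
    d = n ∸ c

-- Counting elements of the positive range.

ℋ⁺⇒p : ∀ {m} → ℋ⁺ m → ∃ λ n → m + n ≡ p n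
ℋ⁺⇒p {m} (n , _ , m≡Hn) = n , ℤₚ.+-injective (begin
  ℤ.+ m ℤ.+ ℤ.+ n                      ≡⟨ cong (ℤ._+ ℤ.+ n) m≡Hn ⟩
  ℤ.+ p n ℤ.- ℤ.+ n ℤ.+ ℤ.+ n          ≡⟨ ℤₚ.+-assoc (ℤ.+ p n) (ℤ.- ℤ.+ n) (ℤ.+ n) ⟩
  ℤ.+ p n ℤ.+ (ℤ.- ℤ.+ n ℤ.+ ℤ.+ n)    ≡⟨ cong (ℤ._+_ (ℤ.+ p n)) (ℤₚ.+-inverseˡ (ℤ.+ n)) ⟩
  ℤ.+ p n ℤ.+ ℤ.0ℤ                     ≡⟨ ℤₚ.+-identityʳ (ℤ.+ p n) ⟩
  ℤ.+ p n                              ∎)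
  where open ≡-Reasoning

-- If n * suc M ≤ p n for n ≥ J, then H n ≤ B forces n < J or n * M ≤ B.
ℋ⁺-count-bound : ∀ M .{{_ : NonZero M}} → ∃ λ J → ∀ B {xs} → Unique xs →
                 (∀ {m} → m ∈ xs → ℋ⁺ m × m ≤ B) → length xs ≤ J + suc (B / M)
ℋ⁺-count-bound M = J , bound
  where
  J = proj₁ (p-superlinear (suc M))

  bound : ∀ B {xs} → Unique xs → (∀ {m} → m ∈ xs → ℋ⁺ m × m ≤ B) → length xs ≤ J + suc (B / M)
  -- All of `xs` lies among the values of `h` at the first `L` indices. Repeated values of `h` do no
  -- harm to an upper bound.
  bound B {xs} u xs⊆ = subst (length xs ≤_) (trans (length-map h (upTo L)) (length-upTo L))
    (unique-⊆⇒length-≤ u incl)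
    where
    L = J + suc (B / M)
    h : ℕ → ℕ
    h n = p n ∸ n

    index< : ∀ {m n} → m ≤ B → m + n ≡ p n → n < L
    index< {m} {n} m≤B m+n≡pn with J ≤? n
    ... | no  J≰n = ≤-trans (≰⇒> J≰n) (m≤m+n J _)
    ... | yes J≤n = ≤-trans (s≤s (subst (_≤ B / M) (m*n/n≡m n M) (/-monoˡ-≤ M nM≤B))) (m≤n+m _ J)
      where
      nM≤B : n * M ≤ B
      -- Adding `n` to `m` uses up one unit of the slope `suc M`; slope `M` remains for `m` itself.
      nM≤B = ≤-trans (+-cancelˡ-≤ n _ _ (begin
        n + n * M  ≡⟨ *-suc n M ⟨
        n * suc M  ≤⟨ proj₂ (p-superlinear (suc M)) J≤n ⟩
        p n        ≡⟨ m+n≡pn ⟨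
        m + n      ≡⟨ +-comm m n ⟩
        n + m      ∎)) m≤B
        where open ≤-Reasoning

    incl : ∀ {m} → m ∈ xs → m ∈ map h (upTo L)
    incl {m} m∈ with m∈ℋ , m≤B ← xs⊆ m∈ with n , m+n≡pn ← ℋ⁺⇒p m∈ℋ =
      subst (_∈ map h (upTo L)) (trans (cong (_∸ n) (sym m+n≡pn)) (m+n∸n≡m m n))
        (∈-map⁺ h (∈-upTo⁺ (index< m≤B m+n≡pn)))

-- Slope `2 * b` bounds `b * length xs` by about `N / 2`, and the other half of `N` absorbs the
-- constants.
ℋ⁺-sparse : ∀ b .{{_ : NonZero b}} → ∃ λ X → ∀ N {xs} → X ≤ N → Unique xs →
            (∀ {m} → m ∈ xs → ℋ⁺ m × m ≤ suc N) → b * length xs < N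
ℋ⁺-sparse b@(suc _) = X , bound
  where
  J = proj₁ (ℋ⁺-count-bound (2 * b))
  -- The summand 2 covers the `suc` in `suc N` and the strictness of the inequality.
  X = 2 + 2 * b * suc J
  bound : ∀ N {xs} → X ≤ N → Unique xs →
          (∀ {m} → m ∈ xs → ℋ⁺ m × m ≤ suc N) → b * length xs < N
  bound N {xs} X≤N u xs⊆ = *-cancelˡ-< 2 _ _ (begin-strict
    2 * (b * length xs)               ≡⟨ *-assoc 2 b (length xs) ⟨
    2 * b * length xs                 ≤⟨ *-monoʳ-≤ (2 * b) (proj₂ (ℋ⁺-count-bound (2 * b)) (suc N) u xs⊆) ⟩
    2 * b * (J + suc q)               ≡⟨ rearrange (2 * b) J q ⟩
    2 * b * suc J + q * (2 * b)       ≤⟨ +-monoʳ-≤ (2 * b * suc J) (m/n*n≤m (suc N) (2 * b)) ⟩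
    2 * b * suc J + suc N             <⟨ n<1+n _ ⟩
    suc (2 * b * suc J + suc N)       ≡⟨ cong suc (+-suc _ N) ⟩
    X + N                             ≤⟨ +-monoˡ-≤ N X≤N ⟩
    N + N                             ≡⟨ cong (N +_) (+-identityʳ N) ⟨
    2 * N                             ∎)
    where
    open ≤-Reasoning
    q = suc N / (2 * b)
    rearrange : ∀ c j k → c * (j + suc k) ≡ c * suc j + k * c
    rearrange = solve 3 (λ c j k → c :* (j :+ (con 1 :+ k)) := c :* (con 1 :+ j) :+ k :* c) refl
      where open +-*-Solver

-- Comparing naturals with rationals and reals.

-- The gcd normalisation in `fromℕ` is stuck on a variable; passing to unnormalised rationals turns
-- comparisons into integer inequalities.
toℚᵘ-fromℕ : ∀ n → ℚ.toℚᵘ (fromℕ n) ℚᵘ.≃ mkℚᵘ (ℤ.+ n) 0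
toℚᵘ-fromℕ n = ℚₚ.toℚᵘ-fromℚᵘ (mkℚᵘ (ℤ.+ n) 0)

fromℕ-mono-≤ : ∀ {m n} → m ≤ n → fromℕ m ℚ.≤ fromℕ n
fromℕ-mono-≤ {m} {n} m≤n = ℚₚ.toℚᵘ-cancel-≤
  (ℚᵘₚ.≤-respˡ-≃ (ℚᵘₚ.≃-sym (toℚᵘ-fromℕ m)) (ℚᵘₚ.≤-respʳ-≃ (ℚᵘₚ.≃-sym (toℚᵘ-fromℕ n))
    (ℚᵘ.*≤* (ℤₚ.*-monoʳ-≤-nonNeg (ℤ.+ 1) (ℤ.+≤+ m≤n)))))

fromℕ-mono-< : ∀ {m n} → m < n → fromℕ m ℚ.< fromℕ n
fromℕ-mono-< {m} {n} m<n = ℚₚ.toℚᵘ-cancel-<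
  (ℚᵘₚ.<-respˡ-≃ (ℚᵘₚ.≃-sym (toℚᵘ-fromℕ m)) (ℚᵘₚ.<-respʳ-≃ (ℚᵘₚ.≃-sym (toℚᵘ-fromℕ n))
    (ℚᵘ.*<* (ℤₚ.*-monoʳ-<-pos (ℤ.+ 1) (ℤ.+<+ m<n)))))

≤-fromℕ : ∀ q → ∃ λ n → q ℚ.≤ fromℕ n
≤-fromℕ (ℚ.mkℚ (ℤ.+ n) d _) = n , ℚₚ.toℚᵘ-cancel-≤
  (ℚᵘₚ.≤-respʳ-≃ (ℚᵘₚ.≃-sym (toℚᵘ-fromℕ n))
    (ℚᵘ.*≤* (ℤₚ.*-monoˡ-≤-nonNeg (ℤ.+ n) (ℤ.+≤+ (s≤s z≤n)))))
≤-fromℕ (ℚ.mkℚ ℤ.-[1+ _ ] _ _) = 0 , ℚ.*≤* ℤ.-≤+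

-- A positive `ε` has numerator at least 1, so it is at least the reciprocal of its denominator.
fromℕ-<-* : ∀ ε → 0ℚ ℚ.< ε → ∀ {k N} → ℚ.↧ₙ ε * k < N → fromℕ k ℚ.< ε ℚ.* fromℕ N
fromℕ-<-* (ℚ.mkℚ ℤ.+0 _ _) (ℚ.*<* (ℤ.+<+ ()))
fromℕ-<-* (ℚ.mkℚ ℤ.-[1+ _ ] _ _) (ℚ.*<* ())
fromℕ-<-* ε@(ℚ.mkℚ (ℤ.+ suc a) d _) _ {k} {N} bk<N = ℚₚ.toℚᵘ-cancel-<
  (ℚᵘₚ.<-respˡ-≃ (ℚᵘₚ.≃-sym (toℚᵘ-fromℕ k)) (ℚᵘₚ.<-respʳ-≃ (ℚᵘₚ.≃-sym product≃)
    (ℚᵘ.*<* (subst₂ ℤ._<_ (ℤₚ.pos-* k _) (trans (ℤₚ.pos-* (suc a * N) 1) (cong (ℤ._* ℤ.+ 1) (ℤₚ.pos-* (suc a) N)))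
      (ℤ.+<+ (begin-strict
        k * (suc d * 1)  ≡⟨ cong (k *_) (*-identityʳ (suc d)) ⟩
        k * suc d        ≡⟨ *-comm k (suc d) ⟩
        suc d * k        <⟨ bk<N ⟩
        N                ≤⟨ m≤n*m N (suc a) ⟩
        suc a * N        ≡⟨ *-identityʳ (suc a * N) ⟨
        suc a * N * 1    ∎))))))
  where
  open ≤-Reasoning
  product≃ : ℚ.toℚᵘ (ε ℚ.* fromℕ N) ℚᵘ.≃ ℚ.toℚᵘ ε ℚᵘ.* mkℚᵘ (ℤ.+ N) 0
  product≃ = ℚᵘₚ.≃-trans (ℚₚ.toℚᵘ-homo-* ε (fromℕ N)) (ℚᵘₚ.*-congˡ {ℚ.toℚᵘ ε} (toℚᵘ-fromℕ N))

-- Locatedness only brackets x up to an overlap, hence width 2 instead of 1.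
bracket : ∀ x X → fromℕ X <ˡ x → ∃ λ N → X ≤ N × fromℕ N <ˡ x × x <ᵘ fromℕ (2 + N)
bracket x X X<x = search K (ℝ.upper-closed x u<fromℕ (proj₂ (ℝ.upper-exists x)))
  where
  u = proj₁ (ℝ.upper-exists x)
  K = proj₁ (≤-fromℕ u)

  u<fromℕ : u ℚ.< fromℕ (2 + (K + X))
  u<fromℕ = ℚₚ.≤-<-trans (proj₂ (≤-fromℕ u))
    (fromℕ-mono-< (s≤s (≤-trans (m≤m+n K X) (n≤1+n _))))

  -- Descends from an upper bound of `x`: each failed test `suc d + X < x` yields the upper bound
  -- needed for the next `d`, and at `X` the lower bound is given.
  search : ∀ d → x <ᵘ fromℕ (2 + (d + X)) →
           ∃ λ N → X ≤ N × fromℕ N <ˡ x × x <ᵘ fromℕ (2 + N)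
  search zero    x<X+2 = X , ≤-refl , X<x , x<X+2
  search (suc d) x< with ℝ.located x (fromℕ-mono-< (n<1+n (suc d + X)))
  ... | inj₁ <x = suc d + X , m≤n+m X (suc d) , <x , x<
  ... | inj₂ x<′ = search d x<′

≤ˡ-<ᵘ⇒< : ∀ x {m n} → fromℕ m ≤ˡ x → x <ᵘ fromℕ n → m < n
≤ˡ-<ᵘ⇒< x {m} {n} m≤x x<n with n ≤? m
... | no  n≰m = ≰⇒> n≰m
... | yes n≤m = contradiction x<m m≤x
  where
  x<m : x <ᵘ fromℕ m
  -- `upper-closed` needs a strict inequality, so openness first supplies an upper bound `v` below
  -- `n`.
  x<m = let v , v<n , x<v = ℝ.upper-open x x<n in
    ℝ.upper-closed x (ℚₚ.<-≤-trans v<n (fromℕ-mono-≤ n≤m)) x<v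

-- The limit of the proportion.

corollary5p3 : HasNaturalDensity ℋ⁺ 0ℚ
corollary5p3 ε 0<ε = fromℕ X , λ x X<x d → below x d , above x X<x d
  where
  b = ℚ.↧ₙ ε
  X = proj₁ (ℋ⁺-sparse b)

  below : ∀ x d → 0ℚ ℚ.- ε <ˡ proportion ℋ⁺ x d
  -- Any upper bound `u` of `x` is positive, so `- ε` times `u` is negative and hence below the
  -- count `k`.
  below x (0<x , k , _) = u , x<u , ℚₚ.<-≤-trans negative (fromℕ-mono-≤ {0} {k} z≤n)
    where
    u = proj₁ (ℝ.upper-exists x)
    x<u = proj₂ (ℝ.upper-exists x)
    negative : (0ℚ ℚ.- ε) ℚ.* u ℚ.< 0ℚ
    negative = subst₂ ℚ._<_ (cong (ℚ._* u) (sym (ℚₚ.+-identityˡ (ℚ.- ε)))) (ℚₚ.*-zeroˡ u)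
      (ℚₚ.*-monoˡ-<-pos u {{ℚ.positive (ℝ.ordered x 0<x x<u)}} (ℚₚ.neg-antimono-< 0<ε))

  above : ∀ x → fromℕ X <ˡ x → ∀ d → proportion ℋ⁺ x d <ᵘ 0ℚ ℚ.+ ε
  above x X<x (0<x , _ , xs , u , xs⇔ , refl)
    with N , X≤N , N<x , x<N+2 ← bracket x X X<x =
    -- The upper cut of `k / x` asks for a positive rational `l < x` with `k < ε * l`; the lower end
    -- `N` of the bracket serves.
    fromℕ N , fromℕ-mono-< {0} {N} (≤-<-trans z≤n bk<N) , N<x ,
    subst (λ e → fromℕ (length xs) ℚ.< e ℚ.* fromℕ N) (sym (ℚₚ.+-identityˡ ε))
      (fromℕ-<-* ε 0<ε bk<N)
    where
    bk<N : b * length xs < N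
    bk<N = proj₂ (ℋ⁺-sparse b) N X≤N u λ m∈ →
      -- From `m ≤ x < 2 + N` follows `m ≤ suc N`, which is why `ℋ⁺-sparse` allows elements up to
      -- `suc N`.
      let m∈ℋ , m≤x = to (xs⇔ _) m∈ in m∈ℋ , s≤s⁻¹ (≤ˡ-<ᵘ⇒< x m≤x x<N+2)
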